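{- Fix an integer $N\geqslant 2$. For $\theta\in(0,1]$, let $(a_n)_{n=1}^\infty=\mathcal{G}(\theta)$, $e_m=\theta-\sum_{n=1}^m 1/a_n$ for $m\geqslant 0$, and for each $m\geqslant 1$ let $N/b_m$ (with $b_m\in\mathbb{N}$) be the largest fraction with numerator $N$ and positive integer denominator that is strictly smaller than $e_{m-1}$. The set of all $\theta\in(0,1]$ such that $1/a_m=N/b_m$ for all $m\geqslant 1$ is precisely $$\Gamma=\left\{\sum_{n=1}^\infty\frac{1}{c_n}\,:\, (c_n)_{n=1}^\infty\subset\mathbb{N},\ c_1\geqslant 2\text{ and } c_{n+1}\geqslant N c_n^2-c_n+1\text{ for all } n\geqslant 1\right\}.$$ Furthermore, $\Gamma$ contains only irrational numbers.
   Context: $\mathbb{N}$ is the set of positive integers. For $\theta\in(0,1]$ let $G(\theta)=\lfloor 1/\theta\rfloor+1$. The greedy algorithm $\mathcal{G}$ produces the sequence $\mathcal{G}(\theta)=(a_n)_{n=1}^\infty$ of positive integers defined by $a_1=G(\theta)$ and $a_m=G\left(\theta-\sum_{n=1}^{m-1}1/a_n\right)$ for $m\geqslant 2$. -}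

module Defs where

open import Data.Nat.Base as ℕ using (ℕ; zero; suc; NonZero)
open import Data.Integer.Base as ℤ using (ℤ; +_)
open import Data.Rational.Base as ℚ using (ℚ; 0ℚ; 1ℚ; _/_; 1/_)
import Data.Rational.Properties as ℚ
open import Data.Product using (Σ; Σ-syntax; ∃; ∃-syntax; _×_; _,_; proj₁; proj₂)
open import Data.Sum using (_⊎_; inj₁; inj₂; map; swap)
open import Relation.Nullary using (¬_; yes; no)
open import Relation.Binary using (tri<; tri≈; tri>)
open import Relation.Binary.PropositionalEquality
  using (_≡_; refl; sym; trans; cong; subst; subst₂)

-- Real numbers as two-sided, located Dedekind cuts of ℚ: L q means q < x and U q means x < q.
record ℝ : Set₁ where
  field
    L U         : ℚ → Set
    L-inhabited : ∃ L
    U-inhabited : ∃ U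
    L-down      : ∀ {p q} → p ℚ.< q → L q → L p
    U-up        : ∀ {p q} → p ℚ.< q → U p → U q
    L-open      : ∀ {p} → L p → ∃[ q ] p ℚ.< q × L q
    U-open      : ∀ {q} → U q → ∃[ p ] p ℚ.< q × U p
    disjoint    : ∀ {q} → L q → ¬ U q
    located     : ∀ {p q} → p ℚ.< q → L p ⊎ U q

  L<U : ∀ {p q} → L p → U q → p ℚ.< q
  L<U {p} {q} Lp Uq with ℚ.<-cmp p q
  ... | tri< p<q _ _ = p<q
  ... | tri≈ _ refl _ with () ← disjoint Lp Uq
  ... | tri> _ _ q<p with () ← disjoint (L-down q<p Lp) Uq

open ℝ

infix 4 _<_ _≤_ _≈_

_<_ : ℝ → ℝ → Set
x < y = ∃[ q ] U x q × L y q

_≤_ : ℝ → ℝ → Set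
x ≤ y = ∀ q → L x q → L y q

-- The equality of real numbers; distinct records may present the same cut.
_≈_ : ℝ → ℝ → Set
x ≈ y = x ≤ y × y ≤ x

fromℚ : ℚ → ℝ
fromℚ r = record
  { L           = λ q → q ℚ.< r
  ; U           = λ q → r ℚ.< q
  ; L-inhabited = r ℚ.- 1ℚ , subst (r ℚ.- 1ℚ ℚ.<_) (ℚ.+-identityʳ r)
                               (ℚ.+-monoʳ-< r (ℚ.negative⁻¹ (ℚ.- 1ℚ)))
  ; U-inhabited = r ℚ.+ 1ℚ , subst (ℚ._< r ℚ.+ 1ℚ) (ℚ.+-identityʳ r)
                               (ℚ.+-monoʳ-< r (ℚ.positive⁻¹ 1ℚ))
  ; L-down      = ℚ.<-trans
  ; U-up        = λ p<q r<p → ℚ.<-trans r<p p<q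
  ; L-open      = ℚ.<-dense
  ; U-open      = λ r<q → let p , r<p , p<q = ℚ.<-dense r<q in p , p<q , r<p
  ; disjoint    = ℚ.<-asym
  ; located     = λ {p} {q} p<q → loc p q p<q
  }
  where
  loc : ∀ p q → p ℚ.< q → p ℚ.< r ⊎ r ℚ.< q
  loc p q p<q with p ℚ.<? r
  ... | yes p<r = inj₁ p<r
  ... | no  p≮r = inj₂ (ℚ.≤-<-trans (ℚ.≮⇒≥ p≮r) p<q)

0ℝ 1ℝ : ℝ
0ℝ = fromℚ 0ℚ
1ℝ = fromℚ 1ℚ

fromℤ : ℤ → ℝ
fromℤ k = fromℚ (k / 1)

private
  -+-cancel : ∀ p r → (p ℚ.- r) ℚ.+ r ≡ p
  -+-cancel p r = trans (ℚ.+-assoc p (ℚ.- r) r)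
    (trans (cong (p ℚ.+_) (ℚ.+-inverseˡ r)) (ℚ.+-identityʳ p))

  +--cancel : ∀ p r → (p ℚ.+ r) ℚ.- r ≡ p
  +--cancel p r = trans (ℚ.+-assoc p r (ℚ.- r))
    (trans (cong (p ℚ.+_) (ℚ.+-inverseʳ r)) (ℚ.+-identityʳ p))

infixl 6 _-_

-- A real number minus a rational number.
_-_ : ℝ → ℚ → ℝ
x - r = record
  { L           = λ q → L x (q ℚ.+ r)
  ; U           = λ q → U x (q ℚ.+ r)
  ; L-inhabited = back (L x) (L-inhabited x)
  ; U-inhabited = back (U x) (U-inhabited x)
  ; L-down      = λ p<q → L-down x (ℚ.+-monoˡ-< r p<q)
  ; U-up        = λ p<q → U-up x (ℚ.+-monoˡ-< r p<q)
  ; L-open      = λ {p} Lp → let q , p<q , Lq = L-open x Lp in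
                    q ℚ.- r
                  , subst (ℚ._< q ℚ.- r) (+--cancel p r) (ℚ.+-monoˡ-< (ℚ.- r) p<q)
                  , subst (L x) (sym (-+-cancel q r)) Lq
  ; U-open      = λ {q} Uq → let p , p<q , Up = U-open x Uq in
                    p ℚ.- r
                  , subst (p ℚ.- r ℚ.<_) (+--cancel q r) (ℚ.+-monoˡ-< (ℚ.- r) p<q)
                  , subst (U x) (sym (-+-cancel p r)) Up
  ; disjoint    = disjoint x
  ; located     = λ p<q → located x (ℚ.+-monoˡ-< r p<q)
  }
  where
  back : (P : ℚ → Set) → ∃ P → ∃ λ q → P (q ℚ.+ r)
  back P (p , Pp) = p ℚ.- r , subst P (sym (-+-cancel p r)) Pp

private
  -- Division of c by a positive rational q, characterised by quot c q * q ≡ c.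
  quot : ∀ c q → 0ℚ ℚ.< q → ∃[ r ] r ℚ.* q ≡ c
  quot c q 0<q = c ℚ.* 1/ q
    , trans (ℚ.*-assoc c (1/ q) q)
        (trans (cong (c ℚ.*_) (ℚ.*-inverseˡ q)) (ℚ.*-identityʳ c))
    where instance _ = ℚ.>-nonZero 0<q

  *-monoˡ : ∀ {p q} r → 0ℚ ℚ.< r → p ℚ.< q → p ℚ.* r ℚ.< q ℚ.* r
  *-monoˡ r 0<r = ℚ.*-monoˡ-<-pos r {{ℚ.positive 0<r}}

  *-monoʳ : ∀ {p q} r → 0ℚ ℚ.< r → p ℚ.< q → r ℚ.* p ℚ.< r ℚ.* q
  *-monoʳ r 0<r = ℚ.*-monoʳ-<-pos r {{ℚ.positive 0<r}}

  *-cancel : ∀ {p q} r → 0ℚ ℚ.< r → p ℚ.* r ℚ.< q ℚ.* r → p ℚ.< q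
  *-cancel r 0<r = ℚ.*-cancelʳ-<-nonNeg r {{ℚ.nonNegative (ℚ.<⇒≤ 0<r)}}

  0<1 : 0ℚ ℚ.< 1ℚ
  0<1 = ℚ.positive⁻¹ 1ℚ

-- The reciprocal 1/x of a positive real number: p < 1/x iff p q < 1 for some
-- rational q > x, and 1/x < p iff 1 < p q for some rational q with 0 < q < x.
recip : (x : ℝ) → 0ℝ < x → ℝ
recip x (z , 0<z , Lz) = record
  { L           = L′
  ; U           = U′
  ; L-inhabited = let q , Uq = U-inhabited x in
                  0ℚ , q , Uq , subst (ℚ._< 1ℚ) (sym (ℚ.*-zeroˡ q)) 0<1
  ; U-inhabited = let c , 1<c = U-inhabited (fromℚ 1ℚ)
                      r , rz≡c = quot c z 0<z in
                  r , z , 0<z , Lz , subst (1ℚ ℚ.<_) (sym rz≡c) 1<c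
  ; L-down      = λ { p<p′ (q , Uq , p′q<1) →
                      q , Uq , ℚ.<-trans (*-monoˡ q (0<U Uq) p<p′) p′q<1 }
  ; U-up        = λ { p<p′ (q , 0<q , Lq , 1<pq) →
                      q , 0<q , Lq , ℚ.<-trans 1<pq (*-monoˡ q 0<q p<p′) }
  ; L-open      = λ { (q , Uq , pq<1) →
                      let c , pq<c , c<1 = ℚ.<-dense pq<1
                          r , rq≡c = quot c q (0<U Uq) in
                      r , *-cancel q (0<U Uq) (subst (_ ℚ.<_) (sym rq≡c) pq<c)
                        , q , Uq , subst (ℚ._< 1ℚ) (sym rq≡c) c<1 }
  ; U-open      = λ { (q , 0<q , Lq , 1<pq) →
                      let c , 1<c , c<pq = ℚ.<-dense 1<pq
                          r , rq≡c = quot c q 0<q in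
                      r , *-cancel q 0<q (subst (ℚ._< _) (sym rq≡c) c<pq)
                        , q , 0<q , Lq , subst (1ℚ ℚ.<_) (sym rq≡c) 1<c }
  ; disjoint    = λ {p} → disj p
  ; located     = λ {p} {p′} → loc p p′
  }
  where
  L′ U′ : ℚ → Set
  L′ p = ∃[ q ] U x q × p ℚ.* q ℚ.< 1ℚ
  U′ p = ∃[ q ] 0ℚ ℚ.< q × L x q × 1ℚ ℚ.< p ℚ.* q

  0<U : ∀ {q} → U x q → 0ℚ ℚ.< q
  0<U Uq = ℚ.<-trans 0<z (L<U x Lz Uq)

  disj : ∀ p → L′ p → ¬ U′ p
  disj p (q , Uq , pq<1) (q′ , 0<q′ , Lq′ , 1<pq′) = ℚ.<-asym pq<1
    (ℚ.<-trans 1<pq′ (*-monoʳ p 0<p (L<U x Lq′ Uq)))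
    where
    0<p : 0ℚ ℚ.< p
    0<p = *-cancel q′ 0<q′
      (subst (ℚ._< p ℚ.* q′) (sym (ℚ.*-zeroˡ q′)) (ℚ.<-trans 0<1 1<pq′))

  loc : ∀ p p′ → p ℚ.< p′ → L′ p ⊎ U′ p′
  loc p p′ p<p′ with 0ℚ ℚ.<? p
  ... | no  p≯0 = inj₁ (q , proj₂ (U-inhabited x) , ℚ.≤-<-trans pq≤0 0<1)
    where
    q = proj₁ (U-inhabited x)
    pq≤0 : p ℚ.* q ℚ.≤ 0ℚ
    pq≤0 = subst (p ℚ.* q ℚ.≤_) (ℚ.*-zeroˡ q)
      (ℚ.*-monoʳ-≤-nonNeg q
        {{ℚ.nonNegative (ℚ.<⇒≤ (0<U (proj₂ (U-inhabited x))))}} (ℚ.≮⇒≥ p≯0))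
  ... | yes 0<p = map
      (λ Lr → t , Lr , subst₂ ℚ._<_ (ℚ.*-comm t p) vp≡1 (*-monoˡ p 0<p t<v))
      (λ Ls → s , 0<s , Ls , subst₂ ℚ._<_ up′≡1 (ℚ.*-comm s p′) (*-monoˡ p′ 0<p′ u<s))
      (swap (located x s<t))
    where
    0<p′ = ℚ.<-trans 0<p p<p′
    u = proj₁ (quot 1ℚ p′ 0<p′)
    up′≡1 : u ℚ.* p′ ≡ 1ℚ
    up′≡1 = proj₂ (quot 1ℚ p′ 0<p′)
    v = proj₁ (quot 1ℚ p 0<p)
    vp≡1 : v ℚ.* p ≡ 1ℚ
    vp≡1 = proj₂ (quot 1ℚ p 0<p)
    0<u : 0ℚ ℚ.< u
    0<u = *-cancel p′ 0<p′ (subst₂ ℚ._<_ (sym (ℚ.*-zeroˡ p′)) (sym up′≡1) 0<1)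
    u<v : u ℚ.< v
    u<v = *-cancel p 0<p (subst (u ℚ.* p ℚ.<_) (trans up′≡1 (sym vp≡1))
                            (*-monoʳ u 0<u p<p′))
    s = proj₁ (ℚ.<-dense u<v)
    u<s = proj₁ (proj₂ (ℚ.<-dense u<v))
    s<v = proj₂ (proj₂ (ℚ.<-dense u<v))
    t = proj₁ (ℚ.<-dense s<v)
    s<t = proj₁ (proj₂ (ℚ.<-dense s<v))
    t<v = proj₂ (proj₂ (ℚ.<-dense s<v))
    0<s = ℚ.<-trans 0<u u<s

_∈⟨0,1] : ℝ → Set
x ∈⟨0,1] = 0ℝ < x × x ≤ 1ℝ

Irrational : ℝ → Set
Irrational x = ∀ q → ¬ (x ≈ fromℚ q)

-- All sequences are indexed from 0, so that a m stands for a_{m+1}.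

record ℕ⁺ : Set where
  constructor pos
  field
    value       : ℕ
    .{{nonZero}} : NonZero value

open ℕ⁺ public

infix 7 _÷_

_÷_ : ℕ → ℕ⁺ → ℚ
k ÷ b = + k / value b

-- partialSum a m = 1/a_1 + … + 1/a_m
partialSum : (ℕ → ℕ⁺) → ℕ → ℚ
partialSum a zero    = 0ℚ
partialSum a (suc m) = partialSum a m ℚ.+ 1 ÷ a m

-- Convergence of Σ 1/c_n to x, where |S - x| < ε is split into S - ε < x and
-- x < S + ε.
∑1/_⟶_ : (ℕ → ℕ⁺) → ℝ → Set
∑1/ c ⟶ x = ∀ ε → 0ℚ ℚ.< ε → ∃[ M ] ∀ m → M ℕ.≤ m →
  fromℚ (partialSum c m ℚ.- ε) < x × x < fromℚ (partialSum c m ℚ.+ ε)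

IsFloor : ℝ → ℤ → Set
IsFloor y k = fromℤ k ≤ y × y < fromℤ (k ℤ.+ + 1)

-- The graph of G : (0,1] → ℕ⁺, G(θ) = ⌊1/θ⌋ + 1.  It is a relation because the
-- floor of a real number is not a constructively definable function.
G[_]≡_ : ℝ → ℕ⁺ → Set
G[ θ ]≡ a = Σ (θ ∈⟨0,1]) λ (0<θ , _) →
  ∃[ k ] IsFloor (recip θ 0<θ) k × + value a ≡ k ℤ.+ + 1

-- e_m = θ - (1/a_1 + … + 1/a_m)
remainder : ℝ → (ℕ → ℕ⁺) → ℕ → ℝ
remainder θ a m = θ - partialSum a m

-- 𝒢(θ) = (a_n)
𝒢[_]≡_ : ℝ → (ℕ → ℕ⁺) → Set
𝒢[ θ ]≡ a = ∀ m → G[ remainder θ a m ]≡ a m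

-- N/b is the largest fraction with numerator N strictly below x.
IsLargestBelow : ℕ → ℝ → ℕ⁺ → Set
IsLargestBelow N x b =
  fromℚ (N ÷ b) < x × (∀ (b′ : ℕ⁺) → fromℚ (N ÷ b′) < x → N ÷ b′ ℚ.≤ N ÷ b)

-- The θ in (0,1] for which 1/a_m = N/b_m for all m ≥ 1; the sequences a and b
-- are determined by θ.
GreedyUnitFractionsBest : ℕ → ℝ → Set
GreedyUnitFractionsBest N θ = θ ∈⟨0,1] ×
  Σ[ a ∈ (ℕ → ℕ⁺) ] Σ[ b ∈ (ℕ → ℕ⁺) ] 𝒢[ θ ]≡ a
    × (∀ m → IsLargestBelow N (remainder θ a m) (b m))
    × (∀ m → 1 ÷ a m ≡ N ÷ b m)

-- Membership in Γ.  The truncated subtraction is exact, as N c² ≥ c for N ≥ 1.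
Γ : ℕ → ℝ → Set
Γ N x = Σ[ c ∈ (ℕ → ℕ⁺) ] 2 ℕ.≤ value (c 0)
  × (∀ n → N ℕ.* value (c n) ℕ.^ 2 ℕ.∸ value (c n) ℕ.+ 1
           ℕ.≤ value (c (suc n)))
  × ∑1/ c ⟶ x

{-# OPTIONS --safe #-}

-- Write d = N c − 1.  Both sides say that 1/c_m < e_m < N/d_m for all m.  Indeed
-- N/d_m is the next fraction with numerator N above N/(N c_m) = 1/c_m, and
-- 1/c + N/d′ < N/d follows from c′ > c d = N c² − c, while 1/c + 1/c′ < N/d
-- implies c′ > c d.  If e_m = P/Q were rational, then e_{m+1} = (P c_m − Q)/(Q c_m) with
-- N (P c_m − Q) < P, so the numerators would descend for ever.

module Submission where

open import Defs
open import Data.Nat.Base using (ℕ; _≥_)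
open import Data.Product using (_×_)
open import Function.Bundles using (_⇔_)

open import Data.Nat.Base as ℕ using (zero; suc; pred; NonZero; z≤n; s≤s)
import Data.Nat.Properties as ℕ
open import Data.Nat.Tactic.RingSolver using (solve-∀)
open import Data.Integer.Base as ℤ using (+_; -[1+_])
import Data.Integer.Properties as ℤ
open import Data.Rational.Base as ℚ using (ℚ; mkℚ; 0ℚ; 1ℚ)
import Data.Rational.Properties as ℚ
open import Data.Rational.Solver using (module +-*-Solver)
open import Data.Rational.Unnormalised.Base as ℚᵘ using (ℚᵘ; mkℚᵘ)
import Data.Rational.Unnormalised.Properties as ℚᵘ
open import Data.Product using (∃₂; ∃-syntax; _,_; proj₁; proj₂)
open import Data.Sum using (inj₁; inj₂)
open import Data.Empty using (⊥; ⊥-elim)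
open import Function.Base using (flip)
open import Function.Bundles using (mk⇔)
open import Level using (0ℓ)
open import Relation.Binary.Core using (Rel)
open import Relation.Binary.Definitions using (Reflexive; Transitive; _Respectsˡ_; _Respectsʳ_)
open import Relation.Nullary using (¬_; yes; no)
open import Relation.Binary.PropositionalEquality

open ℝ

-- Order and ring identities for rational numbers

<-respˡ : ℚ._<_ Respectsˡ _≡_
<-respˡ = proj₂ (resp₂ ℚ._<_)

<-respʳ : ℚ._<_ Respectsʳ _≡_
<-respʳ = proj₁ (resp₂ ℚ._<_)

≤-respˡ : ℚ._≤_ Respectsˡ _≡_
≤-respˡ = proj₂ (resp₂ ℚ._≤_)

≤-respʳ : ℚ._≤_ Respectsʳ _≡_
≤-respʳ = proj₁ (resp₂ ℚ._≤_)

+-cancelʳ-< : ∀ r {p q} → p ℚ.+ r ℚ.< q ℚ.+ r → p ℚ.< q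
+-cancelʳ-< r {p} {q} lt = ℚ.≰⇒> λ q≤p → ℚ.<-irrefl refl (ℚ.<-≤-trans lt (ℚ.+-monoˡ-≤ r q≤p))

+-assoc-swap : ∀ q s r → q ℚ.+ (s ℚ.+ r) ≡ (r ℚ.+ q) ℚ.+ s
+-assoc-swap = solve 3 (λ q s r → q :+ (s :+ r) := (r :+ q) :+ s) refl
  where open +-*-Solver

+-cancel-swap : ∀ s r t → ((s ℚ.+ r) ℚ.+ t) ℚ.- t ≡ r ℚ.+ s
+-cancel-swap = solve 3 (λ s r t → ((s :+ r) :+ t) :- t := r :+ s) refl
  where open +-*-Solver

+-difference : ∀ s t → s ℚ.+ (t ℚ.- s) ≡ t
+-difference = solve 2 (λ s t → s :+ (t :- s) := t) refl
  where open +-*-Solver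

-- Fractions k ÷ b

infixl 7 _⊗_

_⊗_ : ℕ⁺ → ℕ⁺ → ℕ⁺
b ⊗ b′ = pos (value b ℕ.* value b′) {{ℕ.m*n≢0 (value b) (value b′)}}

value>0 : ∀ b → 0 ℕ.< value b
value>0 b = ℕ.>-nonZero⁻¹ (value b)

suc-pred : ∀ b → suc (pred (value b)) ≡ value b
suc-pred b = ℕ.suc-pred (value b)

-- Division in `ℚ` reduces to lowest terms; the unreduced copy keeps numerator and denominator
-- visible, so that comparisons become cross-multiplications in `ℕ`. The `pred` is there because
-- `mkℚᵘ` stores the denominator minus one.
_÷ᵘ_ : ℕ → ℕ⁺ → ℚᵘ
k ÷ᵘ b = mkℚᵘ (+ k) (pred (value b))

÷≡fromℚᵘ : ∀ k b → k ÷ b ≡ ℚ.fromℚᵘ (k ÷ᵘ b)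
÷≡fromℚᵘ k (pos (suc b)) = refl
÷≡fromℚᵘ k (pos zero {{z}}) = ⊥-elim (ℕ.<-irrefl refl (value>0 (pos zero {{z}})))

toℚᵘ-÷ : ∀ k b → ℚ.toℚᵘ (k ÷ b) ℚᵘ.≃ k ÷ᵘ b
toℚᵘ-÷ k b = ℚᵘ.≃-trans (ℚᵘ.≃-reflexive (cong ℚ.toℚᵘ (÷≡fromℚᵘ k b))) (ℚ.toℚᵘ-fromℚᵘ _)

*-suc-pred : ∀ k b → + k ℤ.* + suc (pred (value b)) ≡ + (k ℕ.* value b)
*-suc-pred k b = trans (cong (λ z → + k ℤ.* + z) (suc-pred b)) (sym (ℤ.pos-* k (value b)))

÷-mono-< : ∀ k b k′ b′ → k ℕ.* value b′ ℕ.< k′ ℕ.* value b → k ÷ b ℚ.< k′ ÷ b′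
÷-mono-< k b k′ b′ lt = ℚ.toℚᵘ-cancel-<
  (ℚᵘ.<-respˡ-≃ (ℚᵘ.≃-sym (toℚᵘ-÷ k b)) (ℚᵘ.<-respʳ-≃ (ℚᵘ.≃-sym (toℚᵘ-÷ k′ b′))
    (ℚᵘ.*<* (subst₂ ℤ._<_ (sym (*-suc-pred k b′)) (sym (*-suc-pred k′ b)) (ℤ.+<+ lt)))))

÷-cancel-< : ∀ k b k′ b′ → k ÷ b ℚ.< k′ ÷ b′ → k ℕ.* value b′ ℕ.< k′ ℕ.* value b
÷-cancel-< k b k′ b′ lt
  with ℚᵘ.<-respˡ-≃ (toℚᵘ-÷ k b) (ℚᵘ.<-respʳ-≃ (toℚᵘ-÷ k′ b′) (ℚ.toℚᵘ-mono-< lt))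
... | ℚᵘ.*<* lt′ = ℤ.drop‿+<+ (subst₂ ℤ._<_ (*-suc-pred k b′) (*-suc-pred k′ b) lt′)

÷-mono-≤ : ∀ k b k′ b′ → k ℕ.* value b′ ℕ.≤ k′ ℕ.* value b → k ÷ b ℚ.≤ k′ ÷ b′
÷-mono-≤ k b k′ b′ le = ℚ.≮⇒≥ λ gt → ℕ.<⇒≱ (÷-cancel-< k′ b′ k b gt) le

÷-cong : ∀ k b k′ b′ → k ℕ.* value b′ ≡ k′ ℕ.* value b → k ÷ b ≡ k′ ÷ b′
÷-cong k b k′ b′ eq = ℚ.≤-antisym
  (÷-mono-≤ k b k′ b′ (ℕ.≤-reflexive eq))
  (÷-mono-≤ k′ b′ k b (ℕ.≤-reflexive (sym eq)))

suc-pred-⊗ : ∀ b b′ →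
  + suc (pred (value (b ⊗ b′))) ≡ + (suc (pred (value b)) ℕ.* suc (pred (value b′)))
suc-pred-⊗ b b′ = cong +_ (trans (suc-pred (b ⊗ b′))
  (sym (cong₂ ℕ._*_ (suc-pred b) (suc-pred b′))))

÷-+ : ∀ k b k′ b′ → k ÷ b ℚ.+ k′ ÷ b′ ≡ (k ℕ.* value b′ ℕ.+ k′ ℕ.* value b) ÷ (b ⊗ b′)
÷-+ k b k′ b′ = ℚ.toℚᵘ-injective (begin
  ℚ.toℚᵘ (k ÷ b ℚ.+ k′ ÷ b′)               ≈⟨ ℚ.toℚᵘ-homo-+ (k ÷ b) (k′ ÷ b′) ⟩
  ℚ.toℚᵘ (k ÷ b) ℚᵘ.+ ℚ.toℚᵘ (k′ ÷ b′)     ≈⟨ ℚᵘ.+-cong (toℚᵘ-÷ k b) (toℚᵘ-÷ k′ b′) ⟩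
  k ÷ᵘ b ℚᵘ.+ k′ ÷ᵘ b′                     ≈⟨ ℚᵘ.*≡* (cong₂ ℤ._*_ numerators (suc-pred-⊗ b b′)) ⟩
  (k ℕ.* value b′ ℕ.+ k′ ℕ.* value b) ÷ᵘ (b ⊗ b′) ≈⟨ toℚᵘ-÷ _ (b ⊗ b′) ⟨
  ℚ.toℚᵘ ((k ℕ.* value b′ ℕ.+ k′ ℕ.* value b) ÷ (b ⊗ b′)) ∎)
  where
  open import Relation.Binary.Reasoning.Setoid ℚᵘ.≃-setoid
  numerators = cong₂ ℤ._+_ (*-suc-pred k b′) (*-suc-pred k′ b)

÷-* : ∀ k b k′ b′ → (k ÷ b) ℚ.* (k′ ÷ b′) ≡ (k ℕ.* k′) ÷ (b ⊗ b′)
÷-* k b k′ b′ = ℚ.toℚᵘ-injective (begin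
  ℚ.toℚᵘ ((k ÷ b) ℚ.* (k′ ÷ b′))           ≈⟨ ℚ.toℚᵘ-homo-* (k ÷ b) (k′ ÷ b′) ⟩
  ℚ.toℚᵘ (k ÷ b) ℚᵘ.* ℚ.toℚᵘ (k′ ÷ b′)     ≈⟨ ℚᵘ.*-cong (toℚᵘ-÷ k b) (toℚᵘ-÷ k′ b′) ⟩
  (k ÷ᵘ b) ℚᵘ.* (k′ ÷ᵘ b′)                 ≈⟨ ℚᵘ.*≡* (cong₂ ℤ._*_ (sym (ℤ.pos-* k k′)) (suc-pred-⊗ b b′)) ⟩
  (k ℕ.* k′) ÷ᵘ (b ⊗ b′)                   ≈⟨ toℚᵘ-÷ _ (b ⊗ b′) ⟨
  ℚ.toℚᵘ ((k ℕ.* k′) ÷ (b ⊗ b′)) ∎)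
  where
  open import Relation.Binary.Reasoning.Setoid ℚᵘ.≃-setoid

0<÷ : ∀ k b → 0 ℕ.< k → 0ℚ ℚ.< k ÷ b
0<÷ k b 0<k = ÷-mono-< 0 (pos 1) k b (subst (0 ℕ.<_) (sym (ℕ.*-identityʳ k)) 0<k)

positive-fraction : ∀ {q} → 0ℚ ℚ.< q → ∃₂ λ p b → q ≡ suc p ÷ b
positive-fraction {mkℚ (+ suc p) d c} _ = p , pos (suc d) , sym (ℚ.↥p/↧p≡p (mkℚ (+ suc p) d c))
positive-fraction {mkℚ (+ zero) d c} (ℚ.*<* (ℤ.+<+ ()))
positive-fraction {mkℚ -[1+ n ] d c} (ℚ.*<* ())

-- Real numbers

L-down-≤ : ∀ x {p q} → p ℚ.≤ q → L x q → L x p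
L-down-≤ x {p} {q} p≤q Lq with p ℚ.<? q
... | yes p<q = L-down x p<q Lq
... | no  p≮q = subst (L x) (ℚ.≤-antisym (ℚ.≮⇒≥ p≮q) p≤q) Lq

U-up-≤ : ∀ x {p q} → p ℚ.≤ q → U x p → U x q
U-up-≤ x {p} {q} p≤q Up with p ℚ.<? q
... | yes p<q = U-up x p<q Up
... | no  p≮q = subst (U x) (ℚ.≤-antisym p≤q (ℚ.≮⇒≥ p≮q)) Up

fromℚ<⇒L : ∀ x {q} → fromℚ q < x → L x q
fromℚ<⇒L x (_ , q<r , Lr) = L-down x q<r Lr

L⇒fromℚ< : ∀ x {q} → L x q → fromℚ q < x
L⇒fromℚ< x = L-open x

<fromℚ⇒U : ∀ x {q} → x < fromℚ q → U x q
<fromℚ⇒U x (_ , Ur , r<q) = U-up x r<q Ur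

U⇒<fromℚ : ∀ x {q} → U x q → x < fromℚ q
U⇒<fromℚ x Uq with U-open x Uq
... | p , p<q , Up = p , Up , p<q

-- `≈` compares lower cuts only, so the strict inequality comes from openness of the upper cut
-- together with disjointness.
≈fromℚ⇒U : ∀ x {q p} → x ≈ fromℚ q → U x p → q ℚ.< p
≈fromℚ⇒U x x≈q Up with U-open x Up
... | p′ , p′<p , Up′ = ℚ.≤-<-trans (ℚ.≮⇒≥ λ p′<q → disjoint x (proj₂ x≈q p′ p′<q) Up′) p′<p

-- A negated lower-cut statement yields an upper bound only with room to spare: the gap between `p`
-- and `q` lets locatedness decide.
¬L⇒<fromℚ : ∀ x {p q} → p ℚ.< q → ¬ L x p → x < fromℚ q
¬L⇒<fromℚ x p<q ¬Lp with ℚ.<-dense p<q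
... | r , p<r , r<q with located x p<r
...   | inj₁ Lp = ⊥-elim (¬Lp Lp)
...   | inj₂ Ur = r , Ur , r<q

-- The relation is a parameter so that increasing and, through `flip`, decreasing sequences are both
-- served.
steps⇒mono : ∀ {A : Set} {_∼_ : Rel A 0ℓ} → Reflexive _∼_ → Transitive _∼_ →
  (f : ℕ → A) → (∀ m → f m ∼ f (suc m)) → ∀ {m n} → m ℕ.≤ n → f m ∼ f n
steps⇒mono {_∼_ = _∼_} rfl trn f step m≤n = go (ℕ.≤⇒≤′ m≤n)
  where
  go : ∀ {m n} → m ℕ.≤′ n → f m ∼ f n
  go (ℕ.≤′-reflexive refl) = rfl
  go (ℕ.≤′-step m≤n) = trn (go m≤n) (step _)

partialSum-mono : ∀ c {m n} → m ℕ.≤ n → partialSum c m ℚ.≤ partialSum c n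
partialSum-mono c = steps⇒mono {_∼_ = ℚ._≤_} ℚ.≤-refl ℚ.≤-trans (partialSum c) λ m →
  ≤-respˡ (ℚ.+-identityʳ _)
    (ℚ.+-monoʳ-≤ (partialSum c m) (ℚ.<⇒≤ (0<÷ 1 (c m) (s≤s z≤n))))

-- The denominators d = N c - 1 and the growth condition

module _ (N : ℕ) (N≥2 : N ≥ 2) where

  N*c≥2 : ∀ c → 2 ℕ.≤ N ℕ.* value c
  N*c≥2 c = ℕ.*-mono-≤ N≥2 (value>0 c)

  instance
    N≢0 : NonZero N
    N≢0 = ℕ.>-nonZero (ℕ.<⇒≤ N≥2)

  -- N ÷ before c is the least fraction with numerator N above 1 ÷ c = N ÷ (N c).
  before : ℕ⁺ → ℕ⁺
  before c = pos (N ℕ.* value c ℕ.∸ 1) {{ℕ.>-nonZero (ℕ.∸-monoˡ-≤ 1 (N*c≥2 c))}}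

  suc-before : ∀ c → suc (value (before c)) ≡ N ℕ.* value c
  suc-before c = trans (ℕ.+-comm 1 _) (ℕ.m∸n+n≡m (ℕ.<⇒≤ (N*c≥2 c)))

  -- `N c² − c` factors as `c (N c − 1)`, so the recursion defining `Γ` says `c′ > c d`.
  growth-bound : ∀ c → N ℕ.* value c ℕ.^ 2 ℕ.∸ value c ℕ.+ 1 ≡ suc (value c ℕ.* value (before c))
  growth-bound c = trans (ℕ.+-comm _ 1) (cong suc (begin
    N ℕ.* k ℕ.^ 2 ℕ.∸ k               ≡⟨ cong₂ ℕ._∸_ (square N k) (sym (ℕ.*-identityʳ k)) ⟩
    k ℕ.* (N ℕ.* k) ℕ.∸ k ℕ.* 1       ≡⟨ ℕ.*-distribˡ-∸ k (N ℕ.* k) 1 ⟨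
    k ℕ.* (N ℕ.* k ℕ.∸ 1)             ∎))
    where
    open ≡-Reasoning
    k = value c
    square : ∀ n k → n ℕ.* (k ℕ.* (k ℕ.* 1)) ≡ k ℕ.* (n ℕ.* k)
    square = solve-∀

  Growth : (ℕ → ℕ⁺) → Set
  Growth c = ∀ n → value (c n) ℕ.* value (before (c n)) ℕ.< value (c (suc n))

  growth⇒< : ∀ c → Growth c → ∀ n → value (c n) ℕ.< value (c (suc n))
  growth⇒< c g n = ℕ.≤-<-trans
    (ℕ.m≤m*n (value (c n)) (value (before (c n))) {{ℕ.>-nonZero (value>0 (before (c n)))}}) (g n)

  -- The true growth is at least doubly exponential, but a linear bound suffices: it keeps every
  -- term at least 2 and makes the reciprocals tend to 0.
  growth⇒≥ : ∀ c → 2 ℕ.≤ value (c 0) → Growth c → ∀ n → n ℕ.+ 2 ℕ.≤ value (c n)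
  growth⇒≥ c c₀≥2 g zero    = c₀≥2
  growth⇒≥ c c₀≥2 g (suc n) = ℕ.≤-<-trans (growth⇒≥ c c₀≥2 g n) (growth⇒< c g n)

  -- Since `N c = d + 1`, the difference `N/d − 1/c` is `1/(c d)`. It exceeds `N/d′` because
  -- `d′ = N c′ − 1 ≥ N c d + N − 1 > N c d`, where the last step uses `N ≥ 2`.
  ÷-before-step : ∀ c c′ → value c ℕ.* value (before c) ℕ.< value c′ →
    1 ÷ c ℚ.+ N ÷ before c′ ℚ.< N ÷ before c
  ÷-before-step c c′ cd<c′ = <-respˡ (sym (÷-+ 1 c N (before c′)))
    (÷-mono-< (1 ℕ.* d′ ℕ.+ N ℕ.* k) (c ⊗ before c′) N (before c) (begin-strict
      (1 ℕ.* d′ ℕ.+ N ℕ.* k) ℕ.* d       ≡⟨ cong (λ z → (1 ℕ.* d′ ℕ.+ z) ℕ.* d) (suc-before c) ⟨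
      (1 ℕ.* d′ ℕ.+ suc d) ℕ.* d         ≡⟨ expand d d′ ⟩
      suc d ℕ.* d ℕ.+ d ℕ.* d′           ≡⟨ cong (λ z → z ℕ.* d ℕ.+ d ℕ.* d′) (suc-before c) ⟩
      N ℕ.* k ℕ.* d ℕ.+ d ℕ.* d′         <⟨ ℕ.+-monoˡ-< (d ℕ.* d′) Nkd<d′ ⟩
      suc d ℕ.* d′                       ≡⟨ cong (ℕ._* d′) (suc-before c) ⟩
      N ℕ.* k ℕ.* d′                     ≡⟨ ℕ.*-assoc N k d′ ⟩
      N ℕ.* (k ℕ.* d′)                   ∎))
    where
    open ℕ.≤-Reasoning
    k = value c
    d = value (before c)
    d′ = value (before c′)
    expand : ∀ d d′ → (1 ℕ.* d′ ℕ.+ suc d) ℕ.* d ≡ suc d ℕ.* d ℕ.+ d ℕ.* d′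
    expand = solve-∀
    Nkd<d′ : N ℕ.* k ℕ.* d ℕ.< d′
    Nkd<d′ = ℕ.≤-pred (begin
      2 ℕ.+ N ℕ.* k ℕ.* d      ≤⟨ ℕ.+-mono-≤ N≥2 (ℕ.≤-reflexive (ℕ.*-assoc N k d)) ⟩
      N ℕ.+ N ℕ.* (k ℕ.* d)    ≡⟨ ℕ.*-suc N (k ℕ.* d) ⟨
      N ℕ.* suc (k ℕ.* d)      ≤⟨ ℕ.*-monoʳ-≤ N cd<c′ ⟩
      N ℕ.* value c′           ≡⟨ suc-before c′ ⟨
      suc d′                   ∎)

  -- The identity `N/d − 1/c = 1/(c d)` turns the hypothesis into `1/c′ < 1/(c d)`.
  ÷-before-growth : ∀ c c′ → 1 ÷ c ℚ.+ 1 ÷ c′ ℚ.< N ÷ before c →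
    value c ℕ.* value (before c) ℕ.< value c′
  ÷-before-growth c c′ lt = ℕ.+-cancelʳ-< (d ℕ.* k′) _ _ (begin-strict
    k ℕ.* d ℕ.+ d ℕ.* k′               ≡⟨ rearrange k d k′ ⟩
    (1 ℕ.* k′ ℕ.+ 1 ℕ.* k) ℕ.* d       <⟨ ÷-cancel-< (1 ℕ.* k′ ℕ.+ 1 ℕ.* k) (c ⊗ c′) N (before c)
                                            (<-respˡ (÷-+ 1 c 1 c′) lt) ⟩
    N ℕ.* (k ℕ.* k′)                   ≡⟨ ℕ.*-assoc N k k′ ⟨
    N ℕ.* k ℕ.* k′                     ≡⟨ cong (ℕ._* k′) (suc-before c) ⟨
    suc d ℕ.* k′                       ∎)
    where
    open ℕ.≤-Reasoning
    k = value c
    k′ = value c′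
    d = value (before c)
    rearrange : ∀ k d k′ → k ℕ.* d ℕ.+ d ℕ.* k′ ≡ (1 ℕ.* k′ ℕ.+ 1 ℕ.* k) ℕ.* d
    rearrange = solve-∀

  Bounds : ℝ → ℕ⁺ → Set
  Bounds e c = L e (1 ÷ c) × U e (N ÷ before c)

  -- Tails of a series with the growth condition

  module _ θ c (growth : Growth c) (conv : ∑1/ c ⟶ θ) where

    private
      S : ℕ → ℚ
      S = partialSum c

      -- Upper counterpart of `S`: `T` decreases and stays above `S`, so each `T m` bounds all later
      -- partial sums.
      T : ℕ → ℚ
      T m = N ÷ before (c m) ℚ.+ S m

      T-step : ∀ m → T (suc m) ℚ.< T m
      T-step m = <-respˡ (sym (+-assoc-swap (N ÷ before (c (suc m))) (S m) (1 ÷ c m)))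
        (ℚ.+-monoˡ-< (S m) (÷-before-step (c m) (c (suc m)) (growth m)))

      S≤T : ∀ m → S m ℚ.≤ T m
      S≤T m = ≤-respˡ (ℚ.+-identityˡ (S m))
        (ℚ.+-monoˡ-≤ (S m) (ℚ.<⇒≤ (0<÷ N (before (c m)) (ℕ.<⇒≤ N≥2))))

      T-anti : ∀ {m n} → m ℕ.≤ n → T n ℚ.≤ T m
      T-anti = steps⇒mono {_∼_ = flip ℚ._≤_} ℚ.≤-refl (flip ℚ.≤-trans) T (λ m → ℚ.<⇒≤ (T-step m))

    tail-lower : ∀ m → L (remainder θ c m) (1 ÷ c m)
    tail-lower m = L-down-≤ θ below (fromℚ<⇒L θ (proj₁ (proj₂ close n (ℕ.m≤m⊔n M (2 ℕ.+ m)))))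
      where
      -- Strictness comes from the next term: the partial sums from index `2 + m` on contain it, so
      -- giving it up as the error still leaves `S m + 1/c_m` below `θ`.
      close = conv (1 ÷ c (suc m)) (0<÷ 1 (c (suc m)) (s≤s z≤n))
      M = proj₁ close
      n = M ℕ.⊔ (2 ℕ.+ m)
      below : 1 ÷ c m ℚ.+ S m ℚ.≤ S n ℚ.- 1 ÷ c (suc m)
      below = ≤-respˡ (+-cancel-swap (S m) (1 ÷ c m) (1 ÷ c (suc m)))
        (ℚ.+-monoˡ-≤ (ℚ.- (1 ÷ c (suc m))) (partialSum-mono c (ℕ.m≤n⊔m M (2 ℕ.+ m))))

    tail-upper : ∀ m → U (remainder θ c m) (N ÷ before (c m))
    tail-upper m = U-up-≤ θ above (<fromℚ⇒U θ (proj₂ (proj₂ close n (ℕ.m≤m⊔n M (suc m)))))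
      where
      0<ε : 0ℚ ℚ.< T m ℚ.- T (suc m)
      0<ε = <-respˡ (ℚ.+-inverseʳ (T (suc m))) (ℚ.+-monoˡ-< (ℚ.- T (suc m)) (T-step m))
      -- With this error ε, `S n ≤ T n ≤ T (suc m)` gives `θ < S n + ε ≤ T m`.
      close = conv (T m ℚ.- T (suc m)) 0<ε
      M = proj₁ close
      n = M ℕ.⊔ suc m
      above : S n ℚ.+ (T m ℚ.- T (suc m)) ℚ.≤ T m
      above = ≤-respʳ (+-difference (T (suc m)) (T m))
        (ℚ.+-monoˡ-≤ (T m ℚ.- T (suc m)) (ℚ.≤-trans (S≤T n) (T-anti (ℕ.m≤n⊔m M (suc m)))))

    tail-bounds : ∀ m → Bounds (remainder θ c m) (c m)
    tail-bounds m = tail-lower m , tail-upper m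

  -- From the bounds to the greedy choice and the largest fraction

  bounds⇒∈⟨0,1] : ∀ e c → 2 ℕ.≤ value c → Bounds e c → e ∈⟨0,1]
  bounds⇒∈⟨0,1] e c c≥2 (lo , up) =
    (1 ÷ c , 0<÷ 1 c (s≤s z≤n) , lo) ,
    λ q Lq → ℚ.<-≤-trans (L<U e Lq up) (÷-mono-≤ N (before c) 1 (pos 1) N≤d)
    where
    open ℕ.≤-Reasoning
    -- `c ≥ 2` gives `d + 1 = N c ≥ 2 N ≥ N + 1`, whence `e < N/d ≤ 1`.
    N≤d : N ℕ.* 1 ℕ.≤ 1 ℕ.* value (before c)
    N≤d = ℕ.≤-pred (begin
      suc (N ℕ.* 1)            ≡⟨ cong suc (ℕ.*-identityʳ N) ⟩
      1 ℕ.+ N                  ≤⟨ ℕ.+-monoˡ-≤ N (ℕ.<⇒≤ N≥2) ⟩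
      N ℕ.+ N                  ≡⟨ cong (N ℕ.+_) (ℕ.*-identityʳ N) ⟨
      N ℕ.+ N ℕ.* 1            ≡⟨ ℕ.*-suc N 1 ⟨
      N ℕ.* 2                  ≤⟨ ℕ.*-monoʳ-≤ N c≥2 ⟩
      N ℕ.* value c            ≡⟨ suc-before c ⟨
      suc (value (before c))   ≡⟨ cong suc (ℕ.*-identityˡ _) ⟨
      suc (1 ℕ.* value (before c)) ∎)

  -- The bounds invert to `d/N < 1/e < c`, and `d/N = c − 1/N` is at least `c − 1`, so the floor is
  -- `c − 1`.
  bounds⇒G : ∀ e c → 2 ℕ.≤ value c → Bounds e c → G[ e ]≡ c
  bounds⇒G e c c≥2 (lo , up) =
    bounds⇒∈⟨0,1] e c c≥2 (lo , up) , + j , (floor≤ , <floor+1) , cong +_ c≡j+1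
    where
    j = value c ℕ.∸ 1
    d = before c
    c≡j+1 : value c ≡ j ℕ.+ 1
    c≡j+1 = sym (ℕ.m∸n+n≡m (value>0 c))
    e>0 = (1 ÷ c , 0<÷ 1 c (s≤s z≤n) , lo)

    jN≤d : j ℕ.* N ℕ.≤ value d
    jN≤d = ℕ.≤-pred (begin
      1 ℕ.+ j ℕ.* N      ≤⟨ ℕ.+-monoˡ-≤ (j ℕ.* N) (ℕ.<⇒≤ N≥2) ⟩
      N ℕ.+ j ℕ.* N      ≡⟨ cong (N ℕ.+_) (ℕ.*-comm j N) ⟩
      N ℕ.+ N ℕ.* j      ≡⟨ ℕ.*-suc N j ⟨
      N ℕ.* suc j        ≡⟨ cong (N ℕ.*_) (trans (ℕ.+-comm 1 j) (sym c≡j+1)) ⟩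
      N ℕ.* value c      ≡⟨ suc-before c ⟨
      suc (value d)      ∎)
      where open ℕ.≤-Reasoning

    floor≤ : fromℤ (+ j) ≤ recip e e>0
    floor≤ q q<j = N ÷ d , up , ℚ.<-≤-trans
      (ℚ.*-monoˡ-<-pos (N ÷ d) {{ℚ.positive (0<÷ N d (ℕ.<⇒≤ N≥2))}} q<j)
      (≤-respˡ (sym (÷-* j (pos 1) N d))
        (÷-mono-≤ (j ℕ.* N) (pos 1 ⊗ d) 1 (pos 1)
          (subst₂ ℕ._≤_ (sym (ℕ.*-identityʳ _))
            (sym (trans (ℕ.*-identityˡ _) (ℕ.*-identityˡ (value d)))) jN≤d)))

    <floor+1 : recip e e>0 < fromℤ (+ j ℤ.+ + 1)
    -- Against `1 ÷ c` itself the product would be exactly 1; openness supplies a larger `r`, still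
    -- below `e`, that makes it exceed 1.
    <floor+1 with L-open e lo
    ... | r , 1/c<r , Lr = U⇒<fromℚ (recip e e>0) {suc-j ÷ pos 1}
      (r , ℚ.<-trans (0<÷ 1 c (s≤s z≤n)) 1/c<r , Lr ,
        <-respˡ c*1/c≡1 (ℚ.*-monoʳ-<-pos (suc-j ÷ pos 1)
          {{ℚ.positive (0<÷ suc-j (pos 1) (subst (0 ℕ.<_) c≡j+1 (value>0 c)))}} 1/c<r))
      where
      suc-j = j ℕ.+ 1
      c*1/c≡1 : (suc-j ÷ pos 1) ℚ.* (1 ÷ c) ≡ 1ℚ
      c*1/c≡1 = trans (÷-* suc-j (pos 1) 1 c) (÷-cong (suc-j ℕ.* 1) (pos 1 ⊗ c) 1 (pos 1)
        (trans (ℕ.*-identityʳ _) (trans (ℕ.*-identityʳ _)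
          (trans (sym c≡j+1) (sym (trans (ℕ.*-identityˡ _) (ℕ.*-identityˡ (value c))))))))

  scaled : ℕ⁺ → ℕ⁺
  scaled c = pos N ⊗ c

  1÷≡N÷scaled : ∀ c → 1 ÷ c ≡ N ÷ scaled c
  1÷≡N÷scaled c = ÷-cong 1 c N (scaled c) (ℕ.*-identityˡ _)

  -- Any `N/b′` below `e` is below `N/d`, so `b′ > d`, that is `b′ ≥ d + 1 = N c`.
  bounds⇒largest : ∀ e c → Bounds e c → IsLargestBelow N e (scaled c)
  bounds⇒largest e c (lo , up) =
    L⇒fromℚ< e (subst (L e) (1÷≡N÷scaled c) lo) ,
    λ b′ lt → ÷-mono-≤ N b′ N (scaled c) (ℕ.*-monoʳ-≤ N
      (subst (ℕ._≤ value b′) (suc-before c)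
        (ℕ.*-cancelˡ-< N _ _ (÷-cancel-< N b′ N (before c) (L<U e (fromℚ<⇒L e lt) up)))))

  Γ⇒growth : ∀ x (γ : Γ N x) → Growth (proj₁ γ)
  Γ⇒growth _ (c , _ , rec , _) n = subst (ℕ._≤ value (c (suc n))) (growth-bound (c n)) (rec n)

  Γ⇒best : ∀ θ → Γ N θ → GreedyUnitFractionsBest N θ
  Γ⇒best θ γ@(c , c₀≥2 , _ , conv) =
    θ∈ , c , (λ m → scaled (c m)) , (λ m → bounds⇒G (remainder θ c m) (c m) (c≥2 m) (bounds m)) ,
    (λ m → bounds⇒largest (remainder θ c m) (c m) (bounds m)) , (λ m → 1÷≡N÷scaled (c m))
    where
    growth = Γ⇒growth θ γ
    bounds : ∀ m → Bounds (remainder θ c m) (c m)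
    bounds = tail-bounds θ c growth conv
    c≥2 : ∀ m → 2 ℕ.≤ value (c m)
    c≥2 m = ℕ.≤-trans (ℕ.m≤n+m 2 m) (growth⇒≥ c c₀≥2 growth m)
    θ∈ : θ ∈⟨0,1]
    θ∈ = bounds⇒∈⟨0,1] θ (c 0) c₀≥2
      -- `remainder θ c 0` is `θ - 0ℚ`, whose cuts are those of `θ` only after an added zero is
      -- removed.
      ( subst (L θ) (ℚ.+-identityʳ _) (proj₁ (bounds 0))
      , subst (U θ) (ℚ.+-identityʳ _) (proj₂ (bounds 0)))

  -- From best unit fractions to Γ

  largest⇒¬L : ∀ e c b → IsLargestBelow N e b → 1 ÷ c ≡ N ÷ b → ¬ L e (N ÷ before c)
  largest⇒¬L e c b (_ , largest) eq Lu =
    -- `N/d > 1/c = N/b`, so `N/d` below `e` would beat the maximal `N/b`.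
    ℚ.<-irrefl refl (ℚ.<-≤-trans (÷-mono-< 1 c N (before c) 1*d<N*c)
      (≤-respʳ (sym eq) (largest (before c) (L⇒fromℚ< e Lu))))
    where
    1*d<N*c : 1 ℕ.* value (before c) ℕ.< N ℕ.* value c
    1*d<N*c = ℕ.≤-reflexive (trans (cong suc (ℕ.*-identityˡ _)) (suc-before c))

  -- `a` itself witnesses membership. The upper bound on its remainders is available only as a
  -- negation, and growth and convergence are both derived from that form.
  best⇒Γ : ∀ θ → GreedyUnitFractionsBest N θ → Γ N θ
  best⇒Γ θ ((_ , θ≤1) , a , b , _ , largest , eq) = a , a₀≥2 , rec , conv
    where
    lower : ∀ m → L (remainder θ a m) (1 ÷ a m)
    lower m = subst (L (remainder θ a m)) (sym (eq m))
      (fromℚ<⇒L (remainder θ a m) (proj₁ (largest m)))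

    upper : ∀ m → ¬ L (remainder θ a m) (N ÷ before (a m))
    upper m = largest⇒¬L (remainder θ a m) (a m) (b m) (largest m) (eq m)

    a₀≥2 : 2 ℕ.≤ value (a 0)
    a₀≥2 = subst (1 ℕ.<_) (ℕ.*-identityˡ _) (÷-cancel-< 1 (a 0) 1 (pos 1)
      (θ≤1 _ (subst (L θ) (ℚ.+-identityʳ _) (lower 0))))

    growth : Growth a
    -- By `lower (suc m)`, the sum of `1 ÷ a m` and `1 ÷ a (suc m)` is below the remainder at `m`;
    -- were `N/d` at most this sum, it would be below that remainder too.
    growth m = ÷-before-growth (a m) (a (suc m)) (ℚ.≰⇒> λ N/d≤ → upper m
      (L-down-≤ (remainder θ a m) N/d≤
        (subst (L θ) (+-assoc-swap (1 ÷ a (suc m)) (partialSum a m) (1 ÷ a m)) (lower (suc m)))))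

    rec : ∀ n → N ℕ.* value (a n) ℕ.^ 2 ℕ.∸ value (a n) ℕ.+ 1 ℕ.≤ value (a (suc n))
    rec n = subst (ℕ._≤ value (a (suc n))) (sym (growth-bound (a n))) (growth n)

    conv : ∑1/ a ⟶ θ
    conv ε 0<ε with positive-fraction 0<ε
    -- The denominator of `ε = (p + 1)/B` serves as threshold: `m ≥ B` gives `a m ≥ m + 2 > B`,
    -- hence `d ≥ N (B + 1) − 1 > N B` and `N/d < 1/B ≤ ε`.
    ... | p , B , refl = value B , λ m M≤m →
        L⇒fromℚ< θ (L-down-≤ θ (S-ε≤ m) (lower m)) ,
        ¬L⇒<fromℚ θ (<S+ε m M≤m) (upper m)
      where
      S-ε≤ : ∀ m → partialSum a m ℚ.- ε ℚ.≤ 1 ÷ a m ℚ.+ partialSum a m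
      S-ε≤ m = ℚ.<⇒≤ (<-respʳ (ℚ.+-comm (partialSum a m) (1 ÷ a m))
        (ℚ.+-monoʳ-< (partialSum a m)
          (ℚ.<-trans (ℚ.neg-antimono-< 0<ε) (0<÷ 1 (a m) (s≤s z≤n)))))

      N/d<ε : ∀ m → value B ℕ.≤ m → N ÷ before (a m) ℚ.< ε
      N/d<ε m M≤m = ÷-mono-< N (before (a m)) (suc p) B (begin-strict
        N ℕ.* value B              <⟨ ℕ.≤-pred (begin
            2 ℕ.+ N ℕ.* value B        ≤⟨ ℕ.+-monoˡ-≤ _ N≥2 ⟩
            N ℕ.+ N ℕ.* value B        ≡⟨ ℕ.*-suc N (value B) ⟨
            N ℕ.* suc (value B)        ≤⟨ ℕ.*-monoʳ-≤ N (ℕ.≤-trans (s≤s M≤m)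
                                            (ℕ.≤-trans (ℕ.≤-reflexive (ℕ.+-comm 1 m))
                                            (ℕ.≤-trans (ℕ.+-monoʳ-≤ m (s≤s z≤n))
                                              (growth⇒≥ a a₀≥2 growth m)))) ⟩
            N ℕ.* value (a m)          ≡⟨ suc-before (a m) ⟨
            suc (value (before (a m))) ∎) ⟩
        value (before (a m))       ≤⟨ ℕ.m≤n*m _ (suc p) ⟩
        suc p ℕ.* value (before (a m)) ∎)
        where open ℕ.≤-Reasoning

      <S+ε : ∀ m → value B ℕ.≤ m → N ÷ before (a m) ℚ.+ partialSum a m ℚ.< partialSum a m ℚ.+ ε
      <S+ε m M≤m = <-respʳ (ℚ.+-comm ε (partialSum a m))
        (ℚ.+-monoˡ-< (partialSum a m) (N/d<ε m M≤m))

  -- Irrationality by descent on numerators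

  numerator-step : ∀ P Q c → P ÷ Q ℚ.< N ÷ before c → 1 ÷ c ℚ.< P ÷ Q →
    ∃[ P′ ] P′ ℕ.< P × P ÷ Q ≡ 1 ÷ c ℚ.+ P′ ÷ (Q ⊗ c)
  numerator-step P Q c up lo = P′ , P′<P , trans
    (÷-cong P Q (1 ℕ.* (q ℕ.* k) ℕ.+ P′ ℕ.* k) (c ⊗ (Q ⊗ c)) cross) (sym (÷-+ 1 c P′ (Q ⊗ c)))
    where
    k = value c
    q = value Q
    d = value (before c)
    -- The subtraction is exact: `1/c < P/Q` gives `Q < P c`.
    P′ = P ℕ.* k ℕ.∸ q
    P′+Q : P′ ℕ.+ q ≡ P ℕ.* k
    P′+Q = ℕ.m∸n+n≡m (ℕ.<⇒≤ (subst (ℕ._< P ℕ.* k) (ℕ.*-identityˡ q)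
      (÷-cancel-< 1 c P Q lo)))

    P′<P : P′ ℕ.< P
    -- From `P d < N Q` follows `N P′ + N Q = P (d + 1) < P + N Q`, so `P′ ≤ N P′ < P`.
    P′<P = ℕ.≤-<-trans (ℕ.m≤n*m P′ N) (ℕ.+-cancelʳ-< (N ℕ.* q) _ _ (begin-strict
      N ℕ.* P′ ℕ.+ N ℕ.* q     ≡⟨ ℕ.*-distribˡ-+ N P′ q ⟨
      N ℕ.* (P′ ℕ.+ q)         ≡⟨ cong (N ℕ.*_) P′+Q ⟩
      N ℕ.* (P ℕ.* k)          ≡⟨ swap N P k ⟩
      P ℕ.* (N ℕ.* k)          ≡⟨ cong (P ℕ.*_) (suc-before c) ⟨
      P ℕ.* suc d              ≡⟨ ℕ.*-suc P d ⟩
      P ℕ.+ P ℕ.* d            <⟨ ℕ.+-monoʳ-< P (÷-cancel-< P Q N (before c) up) ⟩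
      P ℕ.+ N ℕ.* q            ∎))
      where
      open ℕ.≤-Reasoning
      swap : ∀ n p k → n ℕ.* (p ℕ.* k) ≡ p ℕ.* (n ℕ.* k)
      swap = solve-∀

    cross : P ℕ.* (k ℕ.* (q ℕ.* k)) ≡ (1 ℕ.* (q ℕ.* k) ℕ.+ P′ ℕ.* k) ℕ.* q
    cross = begin
      P ℕ.* (k ℕ.* (q ℕ.* k))                     ≡⟨ ℕ.*-assoc P k (q ℕ.* k) ⟨
      P ℕ.* k ℕ.* (q ℕ.* k)                       ≡⟨ cong (ℕ._* (q ℕ.* k)) P′+Q ⟨
      (P′ ℕ.+ q) ℕ.* (q ℕ.* k)                    ≡⟨ expand P′ q k ⟩
      (1 ℕ.* (q ℕ.* k) ℕ.+ P′ ℕ.* k) ℕ.* q        ∎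
      where
      open ≡-Reasoning
      expand : ∀ p q k → (p ℕ.+ q) ℕ.* (q ℕ.* k) ≡ (1 ℕ.* (q ℕ.* k) ℕ.+ p ℕ.* k) ℕ.* q
      expand = solve-∀

  Γ⇒irrational : ∀ x → Γ N x → Irrational x
  Γ⇒irrational x γ@(c , _ , _ , conv) r x≈r = contradict (positive-fraction 0<r)
    where
    bounds : ∀ m → Bounds (remainder x c m) (c m)
    bounds = tail-bounds x c (Γ⇒growth x γ) conv

    0<r : 0ℚ ℚ.< r
    0<r = ℚ.<-trans (<-respʳ (sym (ℚ.+-identityʳ _)) (0<÷ 1 (c 0) (s≤s z≤n)))
      (proj₁ x≈r _ (proj₁ (bounds 0)))

    -- `P/Q` is the remainder at `m`, not necessarily in lowest terms. The bound `n` on its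
    -- numerator makes the recursion structural; no numerator lies below `zero`, so that case is
    -- empty.
    descent : ∀ n m P Q → P ℕ.< n → r ≡ P ÷ Q ℚ.+ partialSum c m → ⊥
    descent (suc n) m P Q P<n r≡ = descent n (suc m) P′ (Q ⊗ c m)
      (ℕ.<-≤-trans P′<P (ℕ.≤-pred P<n))
      (trans r≡ (trans (cong (ℚ._+ partialSum c m) P/Q≡)
        (sym (+-assoc-swap (P′ ÷ (Q ⊗ c m)) (partialSum c m) (1 ÷ c m)))))
      where
      step = numerator-step P Q (c m)
        (+-cancelʳ-< (partialSum c m) (<-respˡ r≡ (≈fromℚ⇒U x x≈r (proj₂ (bounds m)))))
        (+-cancelʳ-< (partialSum c m) (<-respʳ r≡ (proj₁ x≈r _ (proj₁ (bounds m)))))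
      P′ = proj₁ step
      P′<P = proj₁ (proj₂ step)
      P/Q≡ = proj₂ (proj₂ step)

    contradict : (∃₂ λ p b → r ≡ suc p ÷ b) → ⊥
    contradict (p , b , r≡) = descent _ 0 (suc p) b ℕ.≤-refl (trans r≡ (sym (ℚ.+-identityʳ _)))

corollary1p8 : (N : ℕ) → N ≥ 2 →
    (∀ (θ : ℝ) → GreedyUnitFractionsBest N θ ⇔ Γ N θ)
    × (∀ (x : ℝ) → Γ N x → Irrational x)
corollary1p8 N N≥2 =
  (λ θ → mk⇔ (best⇒Γ N N≥2 θ) (Γ⇒best N N≥2 θ)) , Γ⇒irrational N N≥2
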